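{- Let $\mathcal{R}_0$ be a set of nontrivial rules on a finite set $Q$. For rules $(A,q),(A',q')$ define $R(A,q;A',q')=((A\cup A')\setminus\{q,q'\},q)$. Let $\mathcal{R}$ be the set obtained from $\mathcal{R}_0$ by repeatedly doing the following until no longer possible: if there are nontrivial rules $(A,q),(A',q')\in\mathcal{R}$ such that $R(A,q;A',q')\notin\mathcal{R}$ or $R(A',q';A,q)\notin\mathcal{R}$, add both $R(A,q;A',q')$ and $R(A',q';A,q)$ to $\mathcal{R}$. Then $\mathcal{R}$ is exactly the set of all nontrivial implicates of $\mathcal{A}(\mathcal{R}_0)$; in particular $\mathcal{K}(\mathcal{R})=\mathcal{A}(\mathcal{R}_0)$.
   Context: A rule on $Q$ is a pair $(A,q)$ with $A\subseteq Q$, $q\in Q$; it is nontrivial if $q\notin A$. It accepts $Y\subseteq Q$ if $q\in Y$ implies $Y\cap A\neq\emptyset$. $\mathcal{K}(\mathcal{R})$ is the family of subsets accepted by all rules of $\mathcal{R}$, and $\mathcal{A}(\mathcal{R})$ is the family of $K\in\mathcal{K}(\mathcal{R})$ for which there is a sequence $\emptyset=Y_0\subseteq\dots\subseteq Y_k=K$ of members of $\mathcal{K}(\mathcal{R})$ with $|Y_{i+1}\setminus Y_i|=1$. A rule is an implicate of a family $\mathcal{F}$ if it accepts every member of $\mathcal{F}$.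
   Formalization: "Exactly the set of all nontrivial implicates" is false (Q={a,q,c}, the single rule ({a},q): ({a,c},q) is missed); proved instead: every rule of R is a nontrivial implicate, and each nontrivial implicate (A,q) has some (B,q) in R with B⊆A. -}

module Defs where

open import Data.Nat using (ℕ; suc)
open import Data.Fin using (Fin; zero; suc; inject₁; fromℕ)
open import Data.Fin.Subset using (Subset; _∈_; _∉_; _⊆_; _∪_; _∩_; _─_; ⁅_⁆; ⊥; ∣_∣; Nonempty)
open import Data.List using (List; _∷_)
open import Data.List.Relation.Unary.All using (All)
open import Data.List.Membership.Propositional using () renaming (_∈_ to _∈ₗ_; _∉_ to _∉ₗ_)
open import Data.Product using (∃; _×_; _,_)
open import Data.Sum using (_⊎_)
open import Level using (0ℓ)
open import Relation.Binary.Construct.Closure.ReflexiveTransitive using (Star)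
open import Relation.Binary.PropositionalEquality using (_≡_)
open import Relation.Binary.Rewriting using (IsNormalForm)
open import Relation.Unary using (Pred)

private
  variable
    n : ℕ

-- The finite ground set Q is Fin n.  A set of rules is a list, of which only
-- membership matters: there are finitely many rules on a finite set.
Rule : ℕ → Set
Rule n = Subset n × Fin n

Nontrivial : Pred (Rule n) 0ℓ
Nontrivial (A , q) = q ∉ A

Accepts : Rule n → Pred (Subset n) 0ℓ
Accepts (A , q) Y = q ∈ Y → Nonempty (Y ∩ A)

𝒦 : List (Rule n) → Pred (Subset n) 0ℓ
𝒦 R Y = All (λ r → Accepts r Y) R

𝒜 : List (Rule n) → Pred (Subset n) 0ℓ
𝒜 {n} R K = ∃ λ k → ∃ λ (Y : Fin (suc k) → Subset n) →
    Y zero ≡ ⊥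
  × Y (fromℕ k) ≡ K
  × (∀ i → 𝒦 R (Y i))
  × (∀ (i : Fin k) → Y (inject₁ i) ⊆ Y (suc i) × ∣ Y (suc i) ─ Y (inject₁ i) ∣ ≡ 1)

Implicate : Pred (Subset n) 0ℓ → Pred (Rule n) 0ℓ
Implicate F r = ∀ Y → F Y → Accepts r Y

NontrivialImplicate : Pred (Subset n) 0ℓ → Pred (Rule n) 0ℓ
NontrivialImplicate F r = Nontrivial r × Implicate F r

resolvent : Rule n → Rule n → Rule n
resolvent (A , q) (A′ , q′) = (A ∪ A′) ─ (⁅ q ⁆ ∪ ⁅ q′ ⁆) , q

data _⟶_ (R : List (Rule n)) : List (Rule n) → Set where
  resolve : ∀ {r r′} → r ∈ₗ R → r′ ∈ₗ R → Nontrivial r → Nontrivial r′ →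
            resolvent r r′ ∉ₗ R ⊎ resolvent r′ r ∉ₗ R →
            R ⟶ (resolvent r r′ ∷ resolvent r′ r ∷ R)

-- R is a final outcome of the resolution procedure run on R₀, for some order
-- of the steps.
_ResolvesTo_ : List (Rule n) → List (Rule n) → Set
R₀ ResolvesTo R = Star _⟶_ R₀ R × IsNormalForm _⟶_ R

-- The rules obtained from those of R by enlarging the premise set A of (A , q).
-- Every such rule accepts whatever the original accepts, but the resolution
-- procedure need not produce it: on Q = {a, q, c}, the procedure run on
-- {({a}, q)} stops at once, although ({a, c}, q) is also a nontrivial implicate
-- of 𝒜.  So the outcome of the procedure and the set of nontrivial implicates
-- can only be compared up to enlarging premises.
Weakenings : List (Rule n) → Pred (Rule n) 0ℓ
Weakenings R (A , q) = ∃ λ B → B ⊆ A × (B , q) ∈ₗ R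

{-# OPTIONS --safe #-}
-- Resolution is sound along a chain, because at each step only one of q, q′ can
-- be new.  Conversely, let R be closed under resolution and K ∈ 𝒦 R.  If removing
-- q from K violates a rule (A , p), then A ∩ K = {q}; by closure the resulting
-- relation between p and q is a strict order on K, so some element of K is
-- removable, and iterating gives a chain from ⊥ to K.
module Submission where

open import Defs
import Data.Bool.Properties as Bool
open import Data.Fin using (Fin; zero; suc; inject₁; fromℕ)
open import Data.Fin.Induction using (<-weakInduction; spo-wellFounded)
open import Data.Fin.Properties using (_≟_; any?)
open import Data.Fin.Relation.Unary.Top using (view; view-fromℕ; view-inject₁; ‵fromℕ; ‵inject₁)
open import Data.Fin.Subset using (Subset; inside; outside; _∪_; _∩_; _─_; _-_; ⁅_⁆; ⊥; ∣_∣; Nonempty)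
  renaming (_∈_ to _∈ˢ_; _∉_ to _∉ˢ_; _⊆_ to _⊆ˢ_; _⊂_ to _⊂ˢ_)
open import Data.Fin.Subset.Induction using (⊂-wellFounded; Acc; acc)
open import Data.Fin.Subset.Properties as Subset using (_∈?_)
open import Data.List using (List)
open import Data.List.Membership.Propositional using (_∈_; find)
import Data.List.Membership.DecPropositional as DecMembership
open import Data.List.Relation.Binary.Subset.Propositional using () renaming (_⊆_ to _⊆ₗ_)
open import Data.List.Relation.Unary.All as All using (All; _∷_)
open import Data.List.Relation.Unary.All.Properties using (¬All⇒Any¬)
open import Data.List.Relation.Unary.Any using (there)
open import Data.Nat using (ℕ; suc; _<_; z≤n)
import Data.Nat.Properties as ℕ
open import Data.Product using (∃; _×_; _,_; proj₁; proj₂)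
open import Data.Product.Properties using (≡-dec)
open import Data.Sum using (_⊎_; inj₁; inj₂; [_,_]′)
open import Data.Vec using (_∷_; tabulate; there)
open import Data.Vec.Properties using ([]=⇒lookup; lookup⇒[]=; lookup∘tabulate)
import Data.Vec.Properties as Vec
open import Function using (_∘_; _∘′_)
open import Relation.Binary using (DecidableEquality; IsStrictPartialOrder)
open import Relation.Binary.Construct.Closure.ReflexiveTransitive using (Star; ε; _◅_)
open import Relation.Binary.PropositionalEquality
open import Relation.Binary.Rewriting using (IsNormalForm)
open import Relation.Nullary using (¬_; Dec; does; yes; no; contradiction; ¬?; _×-dec_; _→-dec_; decidable-stable)
open import Relation.Nullary.Decidable using (dec-true)
open import Relation.Unary using (_⊆_; _≐_; Decidable)

private
  variable
    n : ℕ
    p : Subset n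
    R R′ : List (Rule n)

-- Finite subsets: differences, singletons, comprehension.

x∈p─q⁻ : ∀ (p q : Subset n) {x} → x ∈ˢ p ─ q → x ∈ˢ p × x ∉ˢ q
x∈p─q⁻ p q x∈p─q = Subset.p─q⊆p p q x∈p─q , x∉q p q x∈p─q
  where
  x∉q : ∀ {n} (p q : Subset n) {x} → x ∈ˢ p ─ q → x ∉ˢ q
  x∉q (_ ∷ p) (outside ∷ q) (there x∈p─q) (there x∈q) = x∉q p q x∈p─q x∈q
  x∉q (_ ∷ p) (inside  ∷ q) (there x∈p─q) (there x∈q) = x∉q p q x∈p─q x∈q

-- Otherwise `x` survives in `p - y`, and `p` has at least two elements.
∣p∣≡1⇒x≡y : ∀ {x y} → ∣ p ∣ ≡ 1 → x ∈ˢ p → y ∈ˢ p → x ≡ y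
∣p∣≡1⇒x≡y {p = p} {x} {y} ∣p∣≡1 x∈p y∈p with x ≟ y
... | yes x≡y = x≡y
... | no  x≢y = contradiction (subst (1 <_) ∣p∣≡1 1<∣p∣) (ℕ.<-irrefl refl)
  where
  0<∣p-y∣ : 0 < ∣ p - y ∣
  0<∣p-y∣ = ℕ.≤-<-trans z≤n (Subset.x∈p⇒∣p-x∣<∣p∣ (Subset.x∈p∧x≢y⇒x∈p-y x∈p x≢y))
  1<∣p∣ : 1 < ∣ p ∣
  1<∣p∣ = ℕ.≤-<-trans 0<∣p-y∣ (Subset.x∈p⇒∣p-x∣<∣p∣ y∈p)

x∈p⇒p─[p-x]≡⁅x⁆ : ∀ {x} → x ∈ˢ p → p ─ (p - x) ≡ ⁅ x ⁆
x∈p⇒p─[p-x]≡⁅x⁆ {p = p} {x} x∈p = Subset.⊆-antisym to from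
  where
  to : p ─ (p - x) ⊆ˢ ⁅ x ⁆
  to y∈ with x∈p─q⁻ p (p - x) y∈
  ... | y∈p , y∉p-x = decidable-stable (_ ∈? ⁅ x ⁆) (y∉p-x ∘′ Subset.x∈p∧x∉q⇒x∈p─q y∈p)
  from : ⁅ x ⁆ ⊆ˢ p ─ (p - x)
  from y∈⁅x⁆ with refl ← Subset.x∈⁅y⁆⇒x≡y x y∈⁅x⁆ =
    Subset.x∈p∧x∉q⇒x∈p─q x∈p (λ x∈p-x → proj₂ (x∈p─q⁻ p ⁅ x ⁆ x∈p-x) y∈⁅x⁆)

module _ {P : Fin n → Set} (P? : Decidable P) where

  comprehension : Subset n
  comprehension = tabulate (does ∘ P?)

  ∈-comprehension⁺ : ∀ {x} → P x → x ∈ˢ comprehension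
  ∈-comprehension⁺ {x} px =
    lookup⇒[]= x _ (trans (lookup∘tabulate (does ∘ P?) x) (dec-true (P? x) px))

  ∈-comprehension⁻ : ∀ {x} → x ∈ˢ comprehension → P x
  ∈-comprehension⁻ {x} x∈
    with P? x | trans (sym (lookup∘tabulate (does ∘ P?) x)) ([]=⇒lookup x∈)
  -- For `no`, the equation would identify `outside` with `inside`, so that case is absent.
  ... | yes px | _ = px

-- Decidability of acceptance and of derivability by weakening.

_≟ᴿ_ : DecidableEquality (Rule n)
_≟ᴿ_ = ≡-dec (Vec.≡-dec Bool._≟_) _≟_

_∈ᴿ?_ : ∀ (r : Rule n) R → Dec (r ∈ R)
_∈ᴿ?_ = DecMembership._∈?_ _≟ᴿ_

accepts? : ∀ (Y : Subset n) → Decidable (λ r → Accepts r Y)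
accepts? Y (A , q) = (q ∈? Y) →-dec Subset.nonempty? (Y ∩ A)

𝒦? : ∀ (R : List (Rule n)) → Decidable (𝒦 R)
𝒦? R Y = All.all? (accepts? Y) R

weakenings? : ∀ (R : List (Rule n)) → Decidable (Weakenings R)
weakenings? R (A , q) = Subset.anySubset? (λ B → (B Subset.⊆? A) ×-dec ((B , q) ∈ᴿ? R))

-- Resolvents of two rules.

∈-resolvent⁺ : ∀ {A A′ : Subset n} {q q′ x} → x ∈ˢ A ⊎ x ∈ˢ A′ → x ≢ q → x ≢ q′ →
               x ∈ˢ proj₁ (resolvent (A , q) (A′ , q′))
∈-resolvent⁺ {q = q} {q′} x∈A⊎A′ x≢q x≢q′ =
  Subset.x∈p∧x∉q⇒x∈p─q (Subset.x∈p∪q⁺ x∈A⊎A′)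
    ([ x≢q ∘ Subset.x∈⁅y⁆⇒x≡y q , x≢q′ ∘ Subset.x∈⁅y⁆⇒x≡y q′ ]′ ∘ Subset.x∈p∪q⁻ ⁅ q ⁆ ⁅ q′ ⁆)

∈-resolvent⁻ : ∀ {A A′ : Subset n} {q q′ x} → x ∈ˢ proj₁ (resolvent (A , q) (A′ , q′)) →
               (x ∈ˢ A ⊎ x ∈ˢ A′) × x ≢ q × x ≢ q′
∈-resolvent⁻ {A = A} {A′} {q} {q′} x∈ with x∈p─q⁻ (A ∪ A′) (⁅ q ⁆ ∪ ⁅ q′ ⁆) x∈
... | x∈A∪A′ , x∉ = Subset.x∈p∪q⁻ A A′ x∈A∪A′
  , (λ { refl → x∉ (Subset.x∈p∪q⁺ (inj₁ (Subset.x∈⁅x⁆ q))) })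
  , (λ { refl → x∉ (Subset.x∈p∪q⁺ (inj₂ (Subset.x∈⁅x⁆ q′))) })

resolvent-nontrivial : ∀ (r r′ : Rule n) → Nontrivial (resolvent r r′)
resolvent-nontrivial _ _ q∈ = proj₁ (proj₂ (∈-resolvent⁻ q∈)) refl

-- If q is the element added last and Y meets A in q′, then q′ is already in X,
-- so X meets A′, necessarily outside {q, q′}.
resolvent-accepts-step : ∀ {X Y : Subset n} r r′ → Nontrivial r → Nontrivial r′ →
  Accepts r Y → Accepts r′ X → X ⊆ˢ Y → ∣ Y ─ X ∣ ≡ 1 →
  Accepts (resolvent r r′) X → Accepts (resolvent r r′) Y
resolvent-accepts-step {X = X} {Y} (A , q) (A′ , q′) q∉A q′∉A′ accY accX X⊆Y ∣Y─X∣≡1 ih q∈Y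
  with q ∈? X
... | yes q∈X with x , x∈ ← ih q∈X
              with x∈X , x∈B ← Subset.x∈p∩q⁻ X _ x∈ = x , Subset.x∈p∩q⁺ (X⊆Y x∈X , x∈B)
... | no  q∉X with a , a∈ ← accY q∈Y
              with a∈Y , a∈A ← Subset.x∈p∩q⁻ Y A a∈
              with a ≟ q′
...   | no  a≢q′ = a , Subset.x∈p∩q⁺ (a∈Y , ∈-resolvent⁺ (inj₁ a∈A) (λ { refl → q∉A a∈A }) a≢q′)
...   | yes refl with a ∈? X
-- Here `a` and `q` would both be new, hence equal, although only `a` lies in `A`.
...     | no  a∉X = contradiction
                      (∣p∣≡1⇒x≡y ∣Y─X∣≡1 (Subset.x∈p∧x∉q⇒x∈p─q a∈Y a∉X) (Subset.x∈p∧x∉q⇒x∈p─q q∈Y q∉X))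
                      (λ { refl → q∉A a∈A })
...     | yes a∈X with b , b∈ ← accX a∈X
                  with b∈X , b∈A′ ← Subset.x∈p∩q⁻ X A′ b∈ =
  b , Subset.x∈p∩q⁺ (X⊆Y b∈X ,
    ∈-resolvent⁺ (inj₂ b∈A′) (λ { refl → q∉X b∈X }) (λ { refl → q′∉A′ b∈A′ }))

-- Soundness of resolution along chains.

𝒦-⊥ : ∀ (R : List (Rule n)) → 𝒦 R ⊥
𝒦-⊥ R = All.universal (λ _ q∈⊥ → contradiction q∈⊥ Subset.∉⊥) R

𝒜⊆𝒦 : 𝒜 R ⊆ 𝒦 R
𝒜⊆𝒦 {R = R} (k , Y , _ , Yₖ≡K , Y∈𝒦 , _) = subst (𝒦 R) Yₖ≡K (Y∈𝒦 (fromℕ k))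

𝒜-antitone : R ⊆ₗ R′ → 𝒜 R′ ⊆ 𝒜 R
𝒜-antitone R⊆R′ (k , Y , Y₀ , Yₖ , Y∈𝒦 , steps) =
  k , Y , Y₀ , Yₖ , (λ i → All.tabulate (All.lookup (Y∈𝒦 i) ∘ R⊆R′)) , steps

⟶-nontrivial : R ⟶ R′ → All Nontrivial R → All Nontrivial R′
⟶-nontrivial (resolve {r} {r′} _ _ _ _ _) nt =
  resolvent-nontrivial r r′ ∷ resolvent-nontrivial r′ r ∷ nt

-- A step may shrink `𝒦`, but every chain survives unchanged: induction along it, vacuous at `⊥`,
-- shows that its members are accepted by both resolvents.
⟶-𝒜 : R ⟶ R′ → 𝒜 R ⊆ 𝒜 R′
⟶-𝒜 {R = R} (resolve {r} {r′} r∈R r′∈R r-nt r′-nt _) (k , Y , Y₀≡⊥ , Yₖ , Y∈𝒦 , steps) =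
  k , Y , Y₀≡⊥ , Yₖ ,
  (λ i → accepts r-nt r′-nt r∈R r′∈R i ∷ accepts r′-nt r-nt r′∈R r∈R i ∷ Y∈𝒦 i) , steps
  where
  accepts : ∀ {r r′} → Nontrivial r → Nontrivial r′ → r ∈ R → r′ ∈ R →
            ∀ i → Accepts (resolvent r r′) (Y i)
  accepts {r} {r′} r-nt r′-nt r∈R r′∈R = <-weakInduction _
    (λ q∈Y₀ → contradiction (subst (_ ∈ˢ_) Y₀≡⊥ q∈Y₀) Subset.∉⊥)
    (λ i → resolvent-accepts-step r r′ r-nt r′-nt
      (All.lookup (Y∈𝒦 (suc i)) r∈R) (All.lookup (Y∈𝒦 (inject₁ i)) r′∈R)
      (proj₁ (steps i)) (proj₂ (steps i)))

⟶-⊆ : R ⟶ R′ → R ⊆ₗ R′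
⟶-⊆ (resolve _ _ _ _ _) r∈R = there (there r∈R)

⟶*-nontrivial : Star _⟶_ R R′ → All Nontrivial R → All Nontrivial R′
⟶*-nontrivial ε        = λ nt → nt
⟶*-nontrivial (s ◅ ss) = ⟶*-nontrivial ss ∘ ⟶-nontrivial s

⟶*-𝒜 : Star _⟶_ R R′ → 𝒜 R ⊆ 𝒜 R′
⟶*-𝒜 ε        = λ K∈𝒜 → K∈𝒜
⟶*-𝒜 (s ◅ ss) = ⟶*-𝒜 ss ∘ ⟶-𝒜 s

⟶*-⊆ : Star _⟶_ R R′ → R ⊆ₗ R′
⟶*-⊆ ε        = λ r∈R → r∈R
⟶*-⊆ (s ◅ ss) = ⟶*-⊆ ss ∘ ⟶-⊆ s

-- Building chains.

⊥∈𝒜 : ∀ (R : List (Rule n)) → 𝒜 R ⊥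
⊥∈𝒜 R = 0 , (λ _ → ⊥) , refl , refl , (λ _ → 𝒦-⊥ R) , λ ()

-- The new value goes at the top index, and the split follows the top view because `𝒜` describes
-- chains through `fromℕ` and `inject₁`.
module _ {a} {A : Set a} {k} (f : Fin k → A) (y : A) where

  snoc : Fin (suc k) → A
  snoc i with view i
  ... | ‵fromℕ     = y
  ... | ‵inject₁ j = f j

  snoc-fromℕ : snoc (fromℕ k) ≡ y
  snoc-fromℕ rewrite view-fromℕ k = refl

  snoc-inject₁ : ∀ j → snoc (inject₁ j) ≡ f j
  snoc-inject₁ j rewrite view-inject₁ j = refl

𝒜-extend : ∀ {K L : Subset n} → 𝒜 R K → 𝒦 R L → K ⊆ˢ L → ∣ L ─ K ∣ ≡ 1 → 𝒜 R L
𝒜-extend {n} {R} {K} {L} (k , Y , Y₀≡⊥ , Yₖ≡K , Y∈𝒦 , steps) L∈𝒦 K⊆L ∣L─K∣≡1 =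
  suc k , Y′ , trans (snoc-inject₁ Y L zero) Y₀≡⊥ , snoc-fromℕ Y L , Y′∈𝒦 , steps′
  where
  Y′ : Fin (suc (suc k)) → Subset n
  Y′ = snoc Y L

  Y′∈𝒦 : ∀ i → 𝒦 R (Y′ i)
  Y′∈𝒦 i with view i
  ... | ‵fromℕ     = L∈𝒦
  ... | ‵inject₁ j = Y∈𝒦 j

  steps′ : ∀ i → Y′ (inject₁ i) ⊆ˢ Y′ (suc i) × ∣ Y′ (suc i) ─ Y′ (inject₁ i) ∣ ≡ 1
  steps′ i rewrite snoc-inject₁ Y L i with view i
  -- The added step leads from the old end `K` to `L`.
  ... | ‵fromℕ     rewrite Yₖ≡K = K⊆L , ∣L─K∣≡1
  ... | ‵inject₁ j = steps j

-- Completeness for rule sets closed under resolution.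

module Closed {n} {R : List (Rule n)} (nontrivial : All Nontrivial R)
              (closed : ∀ {r r′} → r ∈ R → r′ ∈ R → resolvent r r′ ∈ R) where

  module _ {K : Subset n} (K∈𝒦 : 𝒦 R K) where

    -- p ⊏ q says that q cannot be removed from K before p.
    _⊏_ : Fin n → Fin n → Set
    p ⊏ q = p ∈ˢ K × ∃ λ A → (A , p) ∈ R × q ∈ˢ A × (∀ {x} → x ∈ˢ K → x ∈ˢ A → x ≡ q)

    ⊏-irrefl : ∀ {p q} → p ≡ q → ¬ p ⊏ q
    ⊏-irrefl refl (_ , _ , r∈R , q∈A , _) = All.lookup nontrivial r∈R q∈A

    -- Resolving eliminates `q` in favour of `A′`, which meets `K` only in `s`.
    ⊏-trans : ∀ {p q s} → p ⊏ q → q ⊏ s → p ⊏ s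
    ⊏-trans {p} {q} {s} (p∈K , A , r∈R , _ , A∩K≡q) (_ , A′ , r′∈R , _ , A′∩K≡s) =
      p∈K , _ , closed r∈R r′∈R , s∈B , B∩K≡s
      where
      B : Subset n
      B = proj₁ (resolvent (A , p) (A′ , q))
      B∩K≡s : ∀ {x} → x ∈ˢ K → x ∈ˢ B → x ≡ s
      B∩K≡s x∈K x∈B with ∈-resolvent⁻ x∈B
      ... | inj₁ x∈A  , _ , x≢q = contradiction (A∩K≡q x∈K x∈A) x≢q
      ... | inj₂ x∈A′ , _ , _   = A′∩K≡s x∈K x∈A′
      s∈B : s ∈ˢ B
      -- Knowing `s ∈ˢ A′` is not enough, since `s` might be `p`. But `K` contains `p` and is
      -- accepted by the resolvent, so `B` meets `K`, necessarily in `s`.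
      s∈B with x , x∈ ← All.lookup K∈𝒦 (closed r∈R r′∈R) p∈K
          with x∈K , x∈B ← Subset.x∈p∩q⁻ K B x∈
          with refl ← B∩K≡s x∈K x∈B = x∈B

    blocked : ∀ {q} → ¬ 𝒦 R (K - q) → ∃ (_⊏ q)
    blocked {q} K-q∉𝒦
      with (A , p) , r∈R , rejects ← find (¬All⇒Any¬ (accepts? (K - q)) R K-q∉𝒦)
      with p ∈? (K - q)
    ... | no  p∉K-q = contradiction (λ p∈K-q → contradiction p∈K-q p∉K-q) rejects
    ... | yes p∈K-q = p , p∈K , A , r∈R , q∈A , A∩K≡q
      where
      p∈K : p ∈ˢ K
      p∈K = proj₁ (x∈p─q⁻ K ⁅ q ⁆ p∈K-q)
      A∩K≡q : ∀ {x} → x ∈ˢ K → x ∈ˢ A → x ≡ q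
      A∩K≡q {x} x∈K x∈A = decidable-stable (x ≟ q) λ x≢q →
        rejects λ _ → x , Subset.x∈p∩q⁺ (Subset.x∈p∧x≢y⇒x∈p-y x∈K x≢q , x∈A)
      q∈A : q ∈ˢ A
      -- `K` itself is accepted, so `A` meets `K`, and only `q` can be the common element.
      q∈A with x , x∈ ← All.lookup K∈𝒦 r∈R p∈K
          with x∈K , x∈A ← Subset.x∈p∩q⁻ K A x∈
          with refl ← A∩K≡q x∈K x∈A = x∈A

    -- Were nothing removable, every element of `K` would have a `⊏`-predecessor in `K`, against
    -- well-foundedness on a finite set.
    removable : Nonempty K → ∃ λ q → q ∈ˢ K × 𝒦 R (K - q)
    removable (q₀ , q₀∈K) with any? (λ q → (q ∈? K) ×-dec 𝒦? R (K - q))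
    ... | yes found = found
    ... | no  none  = contradiction q₀∈K (descend (spo-wellFounded ⊏-spo q₀))
      where
      ⊏-spo : IsStrictPartialOrder _≡_ _⊏_
      ⊏-spo = record
        { isEquivalence = isEquivalence
        ; irrefl        = ⊏-irrefl
        ; trans         = ⊏-trans
        ; <-resp-≈      = resp₂ _⊏_
        }
      descend : ∀ {q} → Acc _⊏_ q → q ∉ˢ K
      descend (acc rec) q∈K with p , p⊏q ← blocked (λ K-q∈𝒦 → none (_ , q∈K , K-q∈𝒦)) =
        descend (rec p⊏q) (proj₁ p⊏q)

  -- Induction on strict inclusion: a chain for `K - q`, with `q` removable, is extended by `K`.
  𝒦⊆𝒜 : 𝒦 R ⊆ 𝒜 R
  𝒦⊆𝒜 = go (⊂-wellFounded _)
    where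
    go : ∀ {K} → Acc _⊂ˢ_ K → 𝒦 R K → 𝒜 R K
    go {K} (acc rec) K∈𝒦 with Subset.nonempty? K
    ... | no  K-empty rewrite Subset.Empty-unique K-empty = ⊥∈𝒜 R
    ... | yes K-nonempty with q , q∈K , K-q∈𝒦 ← removable K∈𝒦 K-nonempty =
      𝒜-extend (go (rec (Subset.x∈p⇒p-x⊂p q∈K)) K-q∈𝒦) K∈𝒦 (Subset.p─q⊆p K ⁅ q ⁆)
        (trans (cong ∣_∣ (x∈p⇒p─[p-x]≡⁅x⁆ q∈K)) (Subset.∣⁅x⁆∣≡1 q))

  -- Resolve away the premises outside A one by one.
  resolve-premises : ∀ {A B p} → (B , p) ∈ R →
    (∀ {b} → b ∈ˢ B → b ∈ˢ A ⊎ Weakenings R (A , b)) → Weakenings R (A , p)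
  resolve-premises {A} {p = p} = go (⊂-wellFounded _)
    where
    go : ∀ {B} → Acc _⊂ˢ_ (B ─ A) → (B , p) ∈ R →
      (∀ {b} → b ∈ˢ B → b ∈ˢ A ⊎ Weakenings R (A , b)) → Weakenings R (A , p)
    go {B} (acc rec) r∈R derivable with Subset.nonempty? (B ─ A)
    ... | no  B─A-empty = B , B⊆A , r∈R
      where
      B⊆A : B ⊆ˢ A
      B⊆A x∈B = decidable-stable (_ ∈? A) λ x∉A →
        B─A-empty (_ , Subset.x∈p∧x∉q⇒x∈p─q x∈B x∉A)
    ... | yes (b , b∈B─A)
      with b∈B , b∉A ← x∈p─q⁻ B A b∈B─A
      with derivable b∈B
    ...   | inj₁ b∈A = contradiction b∈A b∉A
    -- The resolvent trades the premise `b` for premises in `A`, so `B ─ A` loses `b` and gains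
    -- nothing.
    ...   | inj₂ (B′ , B′⊆A , r′∈R) = go (rec smaller) (closed r∈R r′∈R) derivable′
      where
      C : Subset n
      C = proj₁ (resolvent (B , p) (B′ , b))
      derivable′ : ∀ {c} → c ∈ˢ C → c ∈ˢ A ⊎ Weakenings R (A , c)
      derivable′ c∈C with ∈-resolvent⁻ c∈C
      ... | inj₁ c∈B  , _ = derivable c∈B
      ... | inj₂ c∈B′ , _ = inj₁ (B′⊆A c∈B′)
      C─A⊆B─A : C ─ A ⊆ˢ B ─ A
      C─A⊆B─A x∈ with x∈C , x∉A ← x∈p─q⁻ C A x∈ with ∈-resolvent⁻ x∈C
      ... | inj₁ x∈B  , _ = Subset.x∈p∧x∉q⇒x∈p─q x∈B x∉A
      ... | inj₂ x∈B′ , _ = contradiction (B′⊆A x∈B′) x∉A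
      smaller : C ─ A ⊂ˢ B ─ A
      smaller = C─A⊆B─A , b , b∈B─A ,
        λ b∈C─A → proj₂ (proj₂ (∈-resolvent⁻ (proj₁ (x∈p─q⁻ C A b∈C─A)))) refl

  -- The elements outside A that no rule with premises in A concludes form a
  -- member of 𝒦 R disjoint from A, which an implicate (A , q) must accept.
  implicate⇒weakening : NontrivialImplicate (𝒦 R) ⊆ Weakenings R
  implicate⇒weakening {A , q} (q∉A , implicate) =
    decidable-stable (weakenings? R (A , q)) λ q-underivable →
      let x , x∈ = implicate Z Z∈𝒦 (∈-comprehension⁺ Z? (q∉A , q-underivable))
          x∈Z , x∈A = Subset.x∈p∩q⁻ Z A x∈
      in proj₁ (∈-comprehension⁻ Z? x∈Z) x∈A
    where
    Z? : Decidable (λ p → p ∉ˢ A × ¬ Weakenings R (A , p))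
    Z? p = ¬? (p ∈? A) ×-dec ¬? (weakenings? R (A , p))
    Z : Subset n
    Z = comprehension Z?
    -- If `B` missed `Z`, each premise in `B` would lie in `A` or be derivable from it, and then so
    -- would `p`.
    Z∈𝒦 : 𝒦 R Z
    Z∈𝒦 = All.tabulate λ {(B , p)} r∈R p∈Z →
      decidable-stable (Subset.nonempty? (Z ∩ B)) λ Z∩B-empty →
        proj₂ (∈-comprehension⁻ Z? p∈Z) (resolve-premises r∈R (derivable Z∩B-empty))
      where
      derivable : ∀ {B b} → ¬ Nonempty (Z ∩ B) → b ∈ˢ B → b ∈ˢ A ⊎ Weakenings R (A , b)
      derivable {b = b} Z∩B-empty b∈B with b ∈? A | weakenings? R (A , b)
      ... | yes b∈A | _     = inj₁ b∈A
      ... | no  _   | yes w = inj₂ w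
      ... | no  b∉A | no ¬w =
        contradiction (b , Subset.x∈p∩q⁺ (∈-comprehension⁺ Z? (b∉A , ¬w) , b∈B)) Z∩B-empty

-- Outcomes of the procedure.

normalForm⇒closed : All Nontrivial R → IsNormalForm _⟶_ R →
                    ∀ {r r′} → r ∈ R → r′ ∈ R → resolvent r r′ ∈ R
normalForm⇒closed {R = R} nontrivial normal {r} {r′} r∈R r′∈R =
  decidable-stable (resolvent r r′ ∈ᴿ? R) λ new →
    -- A missing resolvent would license one more step; swapping `r` and `r′` covers the other
    -- order.
    normal (_ , resolve r∈R r′∈R (All.lookup nontrivial r∈R) (All.lookup nontrivial r′∈R) (inj₁ new))

theorem3p11 : ∀ {n} (R₀ R : List (Rule n)) →
    All Nontrivial R₀ →
    R₀ ResolvesTo R →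
    ((_∈ R) ⊆ NontrivialImplicate (𝒜 R₀))
    × (NontrivialImplicate (𝒜 R₀) ⊆ Weakenings R)
    × (𝒦 R ≐ 𝒜 R₀)
theorem3p11 R₀ R nontrivial₀ (R₀⟶*R , normal) =
  (λ r∈R → All.lookup nontrivial r∈R , λ Y Y∈𝒜 → All.lookup (𝒜₀⊆𝒦 Y∈𝒜) r∈R) ,
  (λ (nt , implicate) → implicate⇒weakening (nt , λ Y → implicate Y ∘ 𝒦⊆𝒜₀)) ,
  𝒦⊆𝒜₀ , 𝒜₀⊆𝒦
  where
  nontrivial : All Nontrivial R
  nontrivial = ⟶*-nontrivial R₀⟶*R nontrivial₀
  open Closed nontrivial (normalForm⇒closed nontrivial normal)
  𝒜₀⊆𝒦 : 𝒜 R₀ ⊆ 𝒦 R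
  𝒜₀⊆𝒦 = 𝒜⊆𝒦 ∘ ⟶*-𝒜 R₀⟶*R
  𝒦⊆𝒜₀ : 𝒦 R ⊆ 𝒜 R₀
  -- A chain for `R` is one for `R₀`, because the procedure only adds rules.
  𝒦⊆𝒜₀ = 𝒜-antitone (⟶*-⊆ R₀⟶*R) ∘ 𝒦⊆𝒜
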